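{- Let $L$ be an arbitrary complete lattice. There is a bijection between the set of idempotent join-continuous maps $f : L \to L$ (those with $f \circ f = f$) and the set of emmentalers of $L$.
   Context: A map $f : L \to L$ on a complete lattice is join-continuous if $f(\bigvee X) = \bigvee f(X)$ for every subset $X \subseteq L$ (including $X=\emptyset$). An emmentaler of a complete lattice $L$ is a collection $\mathcal{E} = \{[y_i,x_i] \mid i \in I\}$ of closed intervals of $L$ (with $y_i \leq x_i$, where $[y,x] = \{z \in L \mid y \leq z \leq x\}$) such that: (1) $[y_i,x_i] \cap [y_j,x_j] = \emptyset$ for $i,j \in I$ with $i \neq j$; (2) $\{y_i \mid i \in I\}$ is a subset of $L$ closed under arbitrary joins (including the empty join); (3) $\{x_i \mid i \in I\}$ is a subset of $L$ closed under arbitrary meets (including the empty meet). -}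

module Defs where

open import Level using (Level; _⊔_; suc)
open import Data.Product using (_×_; _,_; proj₁; proj₂; ∃)
open import Function.Bundles using (Func; _⟨$⟩_)
open import Relation.Binary.Bundles using (Setoid; Poset)
open import Relation.Binary.Core using (Rel)
open import Relation.Binary.Definitions using (_Respects_)
open import Relation.Nullary using (¬_)
open import Relation.Unary using (Pred; _∈_; _⊆_; _≐_; _≬_; _⊥_)
open import Relation.Unary.Relation.Binary.Equality using (≐-setoid)
open import Axiom.DoubleNegationElimination using (DoubleNegationElimination)
open import Algebra.Definitions using (IdempotentFun)
import Relation.Binary.Construct.On as On
import Function.Relation.Binary.Setoid.Equality as FuncEquality

module _ {c ℓ₁ ℓ₂} (P : Poset c ℓ₁ ℓ₂) where
  open Poset P

  record IsSupremum {p} (X : Pred Carrier p) (s : Carrier) : Set (c ⊔ ℓ₂ ⊔ p) where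
    field
      upper : ∀ x → x ∈ X → x ≤ s
      least : ∀ u → (∀ x → x ∈ X → x ≤ u) → s ≤ u

  record IsInfimum {p} (X : Pred Carrier p) (m : Carrier) : Set (c ⊔ ℓ₂ ⊔ p) where
    field
      lower    : ∀ x → x ∈ X → m ≤ x
      greatest : ∀ l → (∀ x → x ∈ X → l ≤ x) → l ≤ m

-- Subsets are predicates at the level c ⊔ ℓ₁ ⊔ ℓ₂, so that every subset
-- defined by quantifying over the lattice itself has a join and a meet.
-- They need not respect _≈_: a predicate has the same upper and lower bounds
-- as its closure under _≈_.

record CompleteLattice c ℓ₁ ℓ₂ : Set (suc (c ⊔ ℓ₁ ⊔ ℓ₂)) where
  field
    poset : Poset c ℓ₁ ℓ₂

  open Poset poset public

  Subset : Set (suc (c ⊔ ℓ₁ ⊔ ℓ₂))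
  Subset = Pred Carrier (c ⊔ ℓ₁ ⊔ ℓ₂)

  field
    ⋁            : Subset → Carrier
    ⋁-isSupremum : ∀ X → IsSupremum poset X (⋁ X)
    ⋀            : Subset → Carrier
    ⋀-isInfimum  : ∀ X → IsInfimum poset X (⋀ X)

  setoid : Setoid c ℓ₁
  setoid = Eq.setoid

module _ {c ℓ₁ ℓ₂} (L : CompleteLattice c ℓ₁ ℓ₂) where
  open CompleteLattice L

  image : (Carrier → Carrier) → Subset → Subset
  image f X z = ∃ λ x → x ∈ X × z ≈ f x

  JoinContinuous : (Carrier → Carrier) → Set (suc (c ⊔ ℓ₁ ⊔ ℓ₂))
  JoinContinuous f = ∀ X → f (⋁ X) ≈ ⋁ (image f X)

  ClosedUnderJoins : Subset → Set (suc (c ⊔ ℓ₁ ⊔ ℓ₂))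
  ClosedUnderJoins S = ∀ (X : Subset) → X ⊆ S → ⋁ X ∈ S

  ClosedUnderMeets : Subset → Set (suc (c ⊔ ℓ₁ ⊔ ℓ₂))
  ClosedUnderMeets S = ∀ (X : Subset) → X ⊆ S → ⋀ X ∈ S

  record IdempotentJoinContinuousMap : Set (suc (c ⊔ ℓ₁ ⊔ ℓ₂)) where
    field
      map            : Func setoid setoid
      idempotent     : IdempotentFun _≈_ (map ⟨$⟩_)
      joinContinuous : JoinContinuous (map ⟨$⟩_)

  idempotentJoinContinuousMaps : Setoid (suc (c ⊔ ℓ₁ ⊔ ℓ₂)) (c ⊔ ℓ₁)
  idempotentJoinContinuousMaps =
    On.setoid (FuncEquality.setoid setoid setoid) IdempotentJoinContinuousMap.map

  record Interval : Set (c ⊔ ℓ₂) where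
    constructor [_,_]⟨_⟩
    field
      bottom     : Carrier
      top        : Carrier
      bottom≤top : bottom ≤ top

  open Interval

  ⟦_⟧ : Interval → Pred Carrier ℓ₂
  ⟦ I ⟧ z = bottom I ≤ z × z ≤ top I

  _≐ᴵ_ : Rel Interval (c ⊔ ℓ₂)
  I ≐ᴵ J = ⟦ I ⟧ ≐ ⟦ J ⟧

  Collection : Set (suc (c ⊔ ℓ₁ ⊔ ℓ₂))
  Collection = Pred Interval (c ⊔ ℓ₁ ⊔ ℓ₂)

  bottoms : Collection → Subset
  bottoms 𝓔 y = ∃ λ I → I ∈ 𝓔 × y ≈ bottom I

  tops : Collection → Subset
  tops 𝓔 x = ∃ λ I → I ∈ 𝓔 × x ≈ top I

  -- Distinct members are disjoint, in positive form (as for injectivity):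
  -- members with a common point are equal.  See `distinct⇒disjoint` and
  -- `disjoint⇒pairwiseDisjoint` for the comparison with the negative form.

  PairwiseDisjoint : Collection → Set (c ⊔ ℓ₁ ⊔ ℓ₂)
  PairwiseDisjoint 𝓔 = ∀ {I J} → I ∈ 𝓔 → J ∈ 𝓔 → ⟦ I ⟧ ≬ ⟦ J ⟧ → I ≐ᴵ J

  distinct⇒disjoint : ∀ {𝓔} → PairwiseDisjoint 𝓔 →
    ∀ {I J} → I ∈ 𝓔 → J ∈ 𝓔 → ¬ (I ≐ᴵ J) → ⟦ I ⟧ ⊥ ⟦ J ⟧
  distinct⇒disjoint pd I∈𝓔 J∈𝓔 I≢J z∈I∩J = I≢J (pd I∈𝓔 J∈𝓔 (_ , z∈I∩J))

  disjoint⇒pairwiseDisjoint : DoubleNegationElimination (c ⊔ ℓ₂) → ∀ {𝓔} →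
    (∀ {I J} → I ∈ 𝓔 → J ∈ 𝓔 → ¬ (I ≐ᴵ J) → ⟦ I ⟧ ⊥ ⟦ J ⟧) → PairwiseDisjoint 𝓔
  disjoint⇒pairwiseDisjoint dne disj I∈𝓔 J∈𝓔 (_ , z∈I∩J) =
    dne λ I≢J → disj I∈𝓔 J∈𝓔 I≢J z∈I∩J

  -- The collection serves as its own index set, so that distinct indices are
  -- distinct intervals.

  record Emmentaler : Set (suc (c ⊔ ℓ₁ ⊔ ℓ₂)) where
    field
      intervals        : Collection
      respects         : intervals Respects _≐ᴵ_
      pairwiseDisjoint : PairwiseDisjoint intervals
      bottoms-closed   : ClosedUnderJoins (bottoms intervals)
      tops-closed      : ClosedUnderMeets (tops intervals)

  emmentalers : Setoid (suc (c ⊔ ℓ₁ ⊔ ℓ₂)) (c ⊔ ℓ₁ ⊔ ℓ₂)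
  emmentalers = On.setoid (≐-setoid Interval (c ⊔ ℓ₁ ⊔ ℓ₂)) Emmentaler.intervals

{-# OPTIONS --safe #-}

-- A join-continuous f has a right adjoint g, and the emmentaler of an
-- idempotent f consists of the intervals [y , g y] with f y ≈ y: its bottoms
-- form the image of f and its tops the image of g.  Conversely, the bottoms of
-- an emmentaler define an interior operator i and its tops a closure operator
-- c.  By disjointness i and c restrict to mutually inverse bijections between
-- tops and bottoms, whence i ∘ c is idempotent and left adjoint to c ∘ i.

module Submission where

open import Defs
open import Level using (_⊔_; Lift; lift; lower)
open import Data.Product using (_×_; _,_; proj₁; proj₂)
open import Function.Base using (_∘_)
open import Function.Bundles using (Bijection; Func; _⟨$⟩_)
import Function.Consequences.Setoid as Consequences
open import Relation.Unary using (_∈_; _⊆_)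
open import Relation.Binary.Definitions using (_Respects_)
open import Relation.Binary.Bundles using (Setoid)

module _ {c ℓ₁ ℓ₂} (L : CompleteLattice c ℓ₁ ℓ₂) where
  open CompleteLattice L
  open Interval

  private
    module Sup (X : Subset) = IsSupremum (⋁-isSupremum X)
    module Inf (X : Subset) = IsInfimum (⋀-isInfimum X)

    ≥-of : ∀ {x y} → x ≈ y → y ≤ x
    ≥-of = reflexive ∘ Eq.sym

  -- Adjoint functions on a complete lattice.

  Monotone : (Carrier → Carrier) → Set (c ⊔ ℓ₂)
  Monotone f = ∀ {x y} → x ≤ y → f x ≤ f y

  record Adjoint (f g : Carrier → Carrier) : Set (c ⊔ ℓ₂) where
    field
      to   : ∀ {z w} → f z ≤ w → z ≤ g w
      from : ∀ {z w} → z ≤ g w → f z ≤ w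

  monotone⇒cong : ∀ {f} → Monotone f → ∀ {x y} → x ≈ y → f x ≈ f y
  monotone⇒cong mono x≈y = antisym (mono (reflexive x≈y)) (mono (≥-of x≈y))

  leftAdjoint⇒monotone : ∀ {f g} → Adjoint f g → Monotone f
  leftAdjoint⇒monotone f⊣g x≤y = from (trans x≤y (to refl))
    where open Adjoint f⊣g

  -- Transposition moves an upper bound of the image to one of `X` itself, where the join of `X` is
  -- least.
  leftAdjoint⇒joinContinuous : ∀ {f g} → Adjoint f g → JoinContinuous L f
  leftAdjoint⇒joinContinuous {f} f⊣g X = antisym
    (from (Sup.least X _ λ x x∈X →
      to (Sup.upper (image L f X) (f x) (x , x∈X , Eq.refl))))
    (Sup.least (image L f X) _ λ { _ (x , x∈X , z≈fx) →
      trans (reflexive z≈fx) (leftAdjoint⇒monotone f⊣g (Sup.upper X x x∈X)) })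
    where open Adjoint f⊣g

  module _ {f : Carrier → Carrier} (f-cong : ∀ {x y} → x ≈ y → f x ≈ f y)
           (f-⋁ : JoinContinuous L f) where

    -- The down-set of `y` has join `y`, and its image contains `f x`. `Lift` only raises the
    -- down-set to the level at which joins exist.
    joinContinuous⇒monotone : Monotone f
    joinContinuous⇒monotone {x} {y} x≤y =
      trans (Sup.upper (image L f ↓y) (f x) (x , lift x≤y , Eq.refl))
        (trans (≥-of (f-⋁ ↓y)) (reflexive (f-cong ⋁↓y≈y)))
      where
      ↓y : Subset
      ↓y z = Lift (c ⊔ ℓ₁ ⊔ ℓ₂) (z ≤ y)
      ⋁↓y≈y : ⋁ ↓y ≈ y
      ⋁↓y≈y = antisym (Sup.least ↓y y λ _ → lower) (Sup.upper ↓y y (lift refl))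

    private
      below : Carrier → Subset
      below w z = Lift (c ⊔ ℓ₁ ⊔ ℓ₂) (f z ≤ w)

    rightAdjoint : Carrier → Carrier
    rightAdjoint w = ⋁ (below w)

    -- Join-continuity keeps the join of all `z` with `f z ≤ w` inside that set, so it is the
    -- greatest such `z`.
    rightAdjoint-adjoint : Adjoint f rightAdjoint
    rightAdjoint-adjoint = record
      { to   = λ {z} {w} fz≤w → Sup.upper (below w) z (lift fz≤w)
      ; from = λ {z} {w} z≤gw → trans (joinContinuous⇒monotone z≤gw)
          (trans (reflexive (f-⋁ (below w)))
            (Sup.least (image L f (below w)) w λ { _ (_ , lift fx≤w , y≈fx) →
              trans (reflexive y≈fx) fx≤w }))
      }

  -- Intervals and their endpoints.

  ≐ᴵ⇒bottom≈ : ∀ {I J} → _≐ᴵ_ L I J → bottom I ≈ bottom J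
  ≐ᴵ⇒bottom≈ {I} {J} (I⊆J , J⊆I) = antisym
    (proj₁ (J⊆I (refl , bottom≤top J))) (proj₁ (I⊆J (refl , bottom≤top I)))

  ≐ᴵ⇒top≈ : ∀ {I J} → _≐ᴵ_ L I J → top I ≈ top J
  ≐ᴵ⇒top≈ {I} {J} (I⊆J , J⊆I) = antisym
    (proj₂ (I⊆J (bottom≤top I , refl))) (proj₂ (J⊆I (bottom≤top J , refl)))

  endpoints⇒≐ᴵ : ∀ {I J} → bottom I ≈ bottom J → top I ≈ top J → _≐ᴵ_ L I J
  endpoints⇒≐ᴵ b≈ t≈ =
    (λ (b≤z , z≤t) → trans (≥-of b≈) b≤z , trans z≤t (reflexive t≈)) ,
    (λ (b≤z , z≤t) → trans (reflexive b≈) b≤z , trans z≤t (≥-of t≈))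

  -- The interval [y , g y] for a fixed point y of f, where the equation
  -- top ≈ g y is expressed by the adjunction so as not to mention g.
  record IsFixedInterval (f : Carrier → Carrier) (I : Interval L)
         : Set (c ⊔ ℓ₁ ⊔ ℓ₂) where
    field
      fixed : f (bottom I) ≈ bottom I
      to    : ∀ {z} → f z ≤ bottom I → z ≤ top I
      from  : ∀ {z} → z ≤ top I → f z ≤ bottom I

  isFixedInterval-≈ : ∀ {f g} → (∀ x → f x ≈ g x) →
    IsFixedInterval f ⊆ IsFixedInterval g
  isFixedInterval-≈ f≈g {I} I∈f = record
    { fixed = Eq.trans (Eq.sym (f≈g (bottom I))) fixed
    ; to    = λ gz≤b → to (trans (reflexive (f≈g _)) gz≤b)
    ; from  = λ z≤t → trans (≥-of (f≈g _)) (from z≤t)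
    }
    where open IsFixedInterval I∈f

  -- From idempotent maps to emmentalers.

  module FixedIntervals (F : IdempotentJoinContinuousMap L) where
    open IdempotentJoinContinuousMap F

    f : Carrier → Carrier
    f = map ⟨$⟩_

    f-cong : ∀ {x y} → x ≈ y → f x ≈ f y
    f-cong = Func.cong map

    f-mono : Monotone f
    f-mono = joinContinuous⇒monotone f-cong joinContinuous

    g : Carrier → Carrier
    g = rightAdjoint f-cong joinContinuous

    open module F⊣G = Adjoint (rightAdjoint-adjoint f-cong joinContinuous)
    open module Fix {I} (I∈f : IsFixedInterval f I) = IsFixedInterval I∈f
      using (fixed) renaming (to to ≤bottom⇒≤top; from to ≤top⇒≤bottom)

    fixedInterval : ∀ {y} → f y ≈ y → Interval L
    fixedInterval {y} fy≈y = [ y , g y ]⟨ to (reflexive fy≈y) ⟩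

    fixedInterval-isFixedInterval : ∀ {y} (fy≈y : f y ≈ y) →
      IsFixedInterval f (fixedInterval fy≈y)
    fixedInterval-isFixedInterval fy≈y = record
      { fixed = fy≈y ; to = to ; from = from }

    respects : IsFixedInterval f Respects _≐ᴵ_ L
    respects {I} {J} I≐J I∈f = record
      { fixed = Eq.trans (f-cong (Eq.sym b≈)) (Eq.trans (fixed I∈f) b≈)
      ; to    = λ fz≤b → trans (≤bottom⇒≤top I∈f (trans fz≤b (≥-of b≈))) (reflexive t≈)
      ; from  = λ z≤t → trans (≤top⇒≤bottom I∈f (trans z≤t (≥-of t≈))) (reflexive b≈)
      }
      where
      b≈ = ≐ᴵ⇒bottom≈ {I} {J} I≐J
      t≈ = ≐ᴵ⇒top≈ {I} {J} I≐J

    -- Transposing along `J` bounds `f (bottom I)` by `bottom J`, and `f` fixes `bottom I`.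
    bottom≤top⇒bottom≤bottom : ∀ {I J} → IsFixedInterval f I → IsFixedInterval f J →
      bottom I ≤ top J → bottom I ≤ bottom J
    bottom≤top⇒bottom≤bottom I∈f J∈f b≤t =
      trans (≥-of (fixed I∈f)) (≤top⇒≤bottom J∈f b≤t)

    bottom≤bottom⇒top≤top : ∀ {I J} → IsFixedInterval f I → IsFixedInterval f J →
      bottom I ≤ bottom J → top I ≤ top J
    bottom≤bottom⇒top≤top I∈f J∈f b≤b =
      ≤bottom⇒≤top J∈f (trans (≤top⇒≤bottom I∈f refl) b≤b)

    pairwiseDisjoint : PairwiseDisjoint L (IsFixedInterval f)
    pairwiseDisjoint {I} {J} I∈f J∈f (z , (bI≤z , z≤tI) , (bJ≤z , z≤tJ)) =
      endpoints⇒≐ᴵ {I} {J} (antisym bI≤bJ bJ≤bI)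
        (antisym (bottom≤bottom⇒top≤top I∈f J∈f bI≤bJ)
                 (bottom≤bottom⇒top≤top J∈f I∈f bJ≤bI))
      where
      -- The common point `z` places each bottom below the other top.
      bI≤bJ = bottom≤top⇒bottom≤bottom I∈f J∈f (trans bI≤z z≤tJ)
      bJ≤bI = bottom≤top⇒bottom≤bottom J∈f I∈f (trans bJ≤z z≤tI)

    bottoms-closed : ClosedUnderJoins L (bottoms L (IsFixedInterval f))
    bottoms-closed X X⊆B =
      fixedInterval f⋁X≈⋁X , fixedInterval-isFixedInterval f⋁X≈⋁X , Eq.refl
      where
      fx≈x : ∀ {x} → x ∈ X → f x ≈ x
      fx≈x x∈X with X⊆B x∈X
      ... | I , I∈f , x≈b = Eq.trans (f-cong x≈b) (Eq.trans (fixed I∈f) (Eq.sym x≈b))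

      f⋁X≈⋁X : f (⋁ X) ≈ ⋁ X
      f⋁X≈⋁X = antisym
        (from (Sup.least X _ λ x x∈X →
          to (trans (reflexive (fx≈x x∈X)) (Sup.upper X x x∈X))))
        (Sup.least X _ λ x x∈X →
          trans (≥-of (fx≈x x∈X)) (f-mono (Sup.upper X x x∈X)))

    -- The meet `m` is the top of the interval with bottom `f m`, a fixed point by idempotence. For
    -- this, `f z ≤ f m` must force `z ≤ m`: if `I` has its top in `X`, then `m ≤ top I` gives
    -- `f z ≤ f m ≤ bottom I`, hence `z ≤ top I`.
    tops-closed : ClosedUnderMeets L (tops L (IsFixedInterval f))
    tops-closed X X⊆T =
      [ f m , m ]⟨ fz≤fm⇒z≤m (reflexive (idempotent m)) ⟩ ,
      record { fixed = idempotent m ; to = fz≤fm⇒z≤m ; from = f-mono } ,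
      Eq.refl
      where
      m = ⋀ X

      fz≤fm⇒z≤m : ∀ {z} → f z ≤ f m → z ≤ m
      fz≤fm⇒z≤m {z} fz≤fm = Inf.greatest X z bound
        where
        bound : ∀ x → x ∈ X → z ≤ x
        bound x x∈X with X⊆T x∈X
        ... | I , I∈f , x≈t = trans
          (≤bottom⇒≤top I∈f (trans fz≤fm
            (≤top⇒≤bottom I∈f (trans (Inf.lower X x x∈X) (reflexive x≈t)))))
          (≥-of x≈t)

    emmentaler : Emmentaler L
    emmentaler = record
      { intervals        = IsFixedInterval f
      ; respects         = λ {I} {J} → respects {I} {J}
      ; pairwiseDisjoint = pairwiseDisjoint
      ; bottoms-closed   = bottoms-closed
      ; tops-closed      = tops-closed
      }

    -- The fixed interval of `f` with bottom `f z` contains `z`. Being also one of `h`, it gives the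
    -- bound. Used in both directions, this makes the correspondence injective.
    least-fixedInterval : ∀ {h : Carrier → Carrier} →
      IsFixedInterval f ⊆ IsFixedInterval h → ∀ z → h z ≤ f z
    least-fixedInterval f⊆h z = IsFixedInterval.from
      (f⊆h (fixedInterval-isFixedInterval (idempotent z))) (to refl)

  -- From emmentalers to idempotent maps.

  module Operators (𝓔 : Emmentaler L) where
    open Emmentaler 𝓔

    private
      bottomsBelow topsAbove : Carrier → Subset
      bottomsBelow z y = y ∈ bottoms L intervals × y ≤ z
      topsAbove    z x = x ∈ tops L intervals × z ≤ x

    interior closure : Carrier → Carrier
    interior z = ⋁ (bottomsBelow z)
    closure  z = ⋀ (topsAbove z)

    interior≤ : ∀ z → interior z ≤ z
    interior≤ z = Sup.least (bottomsBelow z) z λ _ → proj₂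

    ≤closure : ∀ z → z ≤ closure z
    ≤closure z = Inf.greatest (topsAbove z) z λ _ → proj₂

    interior∈bottoms : ∀ z → interior z ∈ bottoms L intervals
    interior∈bottoms z = bottoms-closed (bottomsBelow z) proj₁

    closure∈tops : ∀ z → closure z ∈ tops L intervals
    closure∈tops z = tops-closed (topsAbove z) proj₁

    ≤⇒≤interior : ∀ {y z} → y ∈ bottoms L intervals → y ≤ z → y ≤ interior z
    ≤⇒≤interior y∈B y≤z = Sup.upper (bottomsBelow _) _ (y∈B , y≤z)

    ≤⇒closure≤ : ∀ {x z} → x ∈ tops L intervals → z ≤ x → closure z ≤ x
    ≤⇒closure≤ x∈T z≤x = Inf.lower (topsAbove _) _ (x∈T , z≤x)

    interior-mono : Monotone interior
    interior-mono x≤y = ≤⇒≤interior (interior∈bottoms _) (trans (interior≤ _) x≤y)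

    closure-mono : Monotone closure
    closure-mono x≤y = ≤⇒closure≤ (closure∈tops _) (trans x≤y (≤closure _))

    bottom∈bottoms : ∀ {I} → I ∈ intervals → bottom I ∈ bottoms L intervals
    bottom∈bottoms I∈𝓔 = _ , I∈𝓔 , Eq.refl

    top∈tops : ∀ {I} → I ∈ intervals → top I ∈ tops L intervals
    top∈tops I∈𝓔 = _ , I∈𝓔 , Eq.refl

    -- The bottom interior (top I) lies in I, so its own interval is I.
    interior-top : ∀ {I} → I ∈ intervals → interior (top I) ≈ bottom I
    interior-top {I} I∈𝓔 with interior∈bottoms (top I)
    ... | J , J∈𝓔 , i≈bJ = Eq.trans i≈bJ (Eq.sym (≐ᴵ⇒bottom≈ {I} {J} I≐J))
      where
      I≐J : _≐ᴵ_ L I J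
      I≐J = pairwiseDisjoint I∈𝓔 J∈𝓔 (bottom J ,
        ( trans (≤⇒≤interior (bottom∈bottoms I∈𝓔) (bottom≤top I)) (reflexive i≈bJ)
        , trans (≥-of i≈bJ) (interior≤ (top I))) ,
        (refl , bottom≤top J))

    -- Dually, the top `closure (bottom I)` lies in `I`, so disjointness identifies its interval
    -- with `I`.
    closure-bottom : ∀ {I} → I ∈ intervals → closure (bottom I) ≈ top I
    closure-bottom {I} I∈𝓔 with closure∈tops (bottom I)
    ... | J , J∈𝓔 , c≈tJ = Eq.trans c≈tJ (Eq.sym (≐ᴵ⇒top≈ {I} {J} I≐J))
      where
      I≐J : _≐ᴵ_ L I J
      I≐J = pairwiseDisjoint I∈𝓔 J∈𝓔 (top J ,
        ( trans (≤closure (bottom I)) (reflexive c≈tJ)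
        , trans (≥-of c≈tJ) (≤⇒closure≤ (top∈tops I∈𝓔) (bottom≤top I))) ,
        (bottom≤top J , refl))

    f : Carrier → Carrier
    f = interior ∘ closure

    f-adjoint : Adjoint f (closure ∘ interior)
    f-adjoint = record { to = to ; from = from }
      where
      to : ∀ {z w} → f z ≤ w → z ≤ closure (interior w)
      -- If `J` has top `closure z`, its bottom is `f z`, hence below `interior w`; applying
      -- `closure` to that bottom recovers the top.
      to {z} {w} fz≤w with closure∈tops z
      ... | J , J∈𝓔 , c≈tJ = trans (≤closure z) (trans (reflexive c≈tJ)
        (trans (≥-of (closure-bottom J∈𝓔)) (closure-mono
          (≤⇒≤interior (bottom∈bottoms J∈𝓔) bJ≤w))))
        where
        bJ≤w : bottom J ≤ w
        bJ≤w = trans (≥-of (interior-top J∈𝓔))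
          (trans (interior-mono (≥-of c≈tJ)) fz≤w)

      from : ∀ {z w} → z ≤ closure (interior w) → f z ≤ w
      -- If `J` has bottom `interior w`, its top is `closure (interior w)`, so `closure z ≤ top J`;
      -- applying `interior` leads down to `bottom J`.
      from {z} {w} z≤ciw with interior∈bottoms w
      ... | J , J∈𝓔 , i≈bJ = trans
        (interior-mono (≤⇒closure≤ (top∈tops J∈𝓔) z≤tJ))
        (trans (reflexive (interior-top J∈𝓔)) (trans (≥-of i≈bJ) (interior≤ w)))
        where
        z≤tJ : z ≤ top J
        z≤tJ = trans z≤ciw
          (trans (closure-mono (reflexive i≈bJ)) (reflexive (closure-bottom J∈𝓔)))

    open Adjoint f-adjoint

    bottom⇒fixed : ∀ {y} → y ∈ bottoms L intervals → f y ≈ y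
    bottom⇒fixed y∈B = antisym
      (from (trans (≤⇒≤interior y∈B refl) (≤closure _)))
      (≤⇒≤interior y∈B (≤closure _))

    f-map : IdempotentJoinContinuousMap L
    f-map = record
      { map            = record
        { to   = f
        ; cong = monotone⇒cong (leftAdjoint⇒monotone f-adjoint)
        }
      -- Every value of `f` is a bottom, and bottoms are fixed.
      ; idempotent     = λ z → bottom⇒fixed (interior∈bottoms (closure z))
      ; joinContinuous = leftAdjoint⇒joinContinuous f-adjoint
      }

    interval⇒fixedInterval : intervals ⊆ IsFixedInterval f
    interval⇒fixedInterval {I} I∈𝓔 = record
      { fixed = bottom⇒fixed (bottom∈bottoms I∈𝓔)
      ; to    = λ fz≤b → trans (to fz≤b)
          (trans (closure-mono (interior≤ _)) (reflexive (closure-bottom I∈𝓔)))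
      ; from  = λ z≤t → trans (interior-mono (≤⇒closure≤ (top∈tops I∈𝓔) z≤t))
          (reflexive (interior-top I∈𝓔))
      }

    -- The member `J` with top `closure (bottom I)` has bottom `f (bottom I)`, which is `bottom I`.
    -- Both tops are then the greatest `z` with `f z ≤ bottom I`, so `J` and `I` agree and
    -- membership transfers.
    fixedInterval⇒interval : IsFixedInterval f ⊆ intervals
    fixedInterval⇒interval {I} I∈f with closure∈tops (bottom I)
    ... | J , J∈𝓔 , c≈tJ = respects (endpoints⇒≐ᴵ {J} {I} bJ≈bI tJ≈tI) J∈𝓔
      where
      module I = IsFixedInterval I∈f

      bJ≈bI : bottom J ≈ bottom I
      bJ≈bI = Eq.trans (Eq.sym (interior-top J∈𝓔))
        (Eq.trans (monotone⇒cong interior-mono (Eq.sym c≈tJ)) I.fixed)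

      tJ≈tI : top J ≈ top I
      tJ≈tI = antisym
        (I.to (trans (interior-mono (≤⇒closure≤ (top∈tops J∈𝓔) refl))
          (reflexive (Eq.trans (interior-top J∈𝓔) bJ≈bI))))
        (trans (to (I.from refl))
          (trans (closure-mono (interior≤ _)) (reflexive c≈tJ)))

theorem1 : ∀ {c ℓ₁ ℓ₂} (L : CompleteLattice c ℓ₁ ℓ₂) →
    Bijection (idempotentJoinContinuousMaps L) (emmentalers L)
theorem1 L = record
  { to        = emmentaler
  ; cong      = λ {F} {G} → emmentaler-cong {F} {G}
  ; bijective =
      -- Injectivity: each inclusion of fixed intervals bounds one map by the other.
      (λ {F} {G} (F⊆G , G⊆F) z → antisym
        (least-fixedInterval G G⊆F z) (least-fixedInterval F F⊆G z))
    , strictlySurjective⇒surjective {emmentaler} (λ {F} {G} → emmentaler-cong {F} {G}) λ 𝓔 →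
        -- The preimage of `𝓔` is its composite of interior and closure, whose fixed intervals are
        -- exactly the members of `𝓔`.
        Operators.f-map L 𝓔 ,
        (Operators.fixedInterval⇒interval L 𝓔 , Operators.interval⇒fixedInterval L 𝓔)
  }
  where
  open CompleteLattice L using (antisym; module Eq)
  open FixedIntervals L using (emmentaler; least-fixedInterval)
  module Maps = Setoid (idempotentJoinContinuousMaps L)
  module Emmentalers = Setoid (emmentalers L)
  open Consequences (idempotentJoinContinuousMaps L) (emmentalers L)
    using (strictlySurjective⇒surjective)

  emmentaler-cong : ∀ {F G} → F Maps.≈ G → emmentaler F Emmentalers.≈ emmentaler G
  emmentaler-cong {F} {G} F≈G =
    isFixedInterval-≈ L (λ x → F≈G x) , isFixedInterval-≈ L (λ x → Eq.sym (F≈G x))
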